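{- For all image-finite processes $p,q$: 1. $p\sqsubseteq_{\mathcal{L}'_{RS}}q \iff BGO_I(p)\subseteq BGO_I(q)$; 2. (a) $p\sqsubseteq_{\mathcal{L}'_{RT}}q\iff p\leq_I^{l}q$; (b) $p\sqsubseteq_{\mathcal{L}'_{FT}}q\iff p\leq_I^{l\supseteq}q$; (c) $p\sqsubseteq_{\mathcal{L}'_{R}}q\iff p\leq_I^{lf}q$; (d) $p\sqsubseteq_{\mathcal{L}'_{F}}q\iff p\leq_I^{lf\supseteq}q$.
   Context: Processes are states of a labelled transition system with action set $Act$ and transitions $p\xrightarrow{a}p'$; $I(p)=\{a\in Act\mid p\xrightarrow{a}\}$. A process is image-finite if every state reachable from it has finitely many $a$-successors for each $a$. Hennessy-Milner formulas: $\varphi::=\bigwedge_{i\in I}\varphi_i\mid a\varphi\mid\neg\varphi$ (arbitrary index sets), where $p\models a\varphi$ iff $p\xrightarrow{a}q$ and $q\models\varphi$ for some $q$, and conjunction and negation have their usual meaning; $\top$ is the empty conjunction. For a set of formulas $\mathcal{L}$: $p\sqsubseteq_{\mathcal{L}}q$ iff for all $\varphi\in\mathcal{L}$, $p\models\varphi$ implies $q\models\varphi$. Each logic is the least set closed under its clauses; $X_1,X_2$ range over arbitrary subsets of $Act$. - $\mathcal{L}'_{RS}$: $a\top$ and $\neg a\top$ for each $a\in Act$; arbitrary conjunctions; prefixes $a\varphi$. - $\mathcal{L}'_{RT}$: $\top$; if $\varphi\in\mathcal{L}'_{RT}$ then $(\bigwedge_{a\in X_1}a\top\wedge\bigwedge_{b\in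 X_2}\neg b\top)\wedge\varphi\in\mathcal{L}'_{RT}$; prefixes $a\varphi$. - $\mathcal{L}'_{FT}$: $\top$; if $\varphi\in\mathcal{L}'_{FT}$ then $(\bigwedge_{a\in X_1}\neg a\top)\wedge\varphi\in\mathcal{L}'_{FT}$; prefixes $a\varphi$. - $\mathcal{L}'_{R}$: $\top$; $\bigwedge_{a\in X_1}a\top\wedge\bigwedge_{b\in X_2}\neg b\top$; prefixes $a\varphi$. - $\mathcal{L}'_{F}$: $\top$; $\bigwedge_{a\in X_1}\neg a\top$; prefixes $a\varphi$. Observations: $BGO_I(p)$ is the set of finite trees defined recursively as all $\langle I(p),S\rangle$ with $S$ a finite subset of $\{(a,bgo)\mid p\xrightarrow{a}p',\ bgo\in BGO_I(p')\}$. $LGO_I(p)$ is the set of sequences $X_0a_1X_1\ldots a_nX_n$ ($n\ge 0$) with $X_i=I(p_i)$ for some $p=p_0\xrightarrow{a_1}p_1\cdots\xrightarrow{a_n}p_n$. $p\leq_I^{l}q$ iff $LGO_I(p)\subseteq LGO_I(q)$. The other three orders require: for every $X_0a_1X_1\ldots X_n\in LGO_I(p)$ there is $Y_0a_1Y_1\ldots Y_n\in LGO_I(q)$ such that: $X_i\supseteq Y_i$ for all $i\in0..n$ (for $\leq_I^{l\supseteq}$); $X_n=Y_n$ (for $\leq_I^{lf}$); $X_n\supseteq Y_n$ (for $\leq_I^{lf\supseteq}$). -}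

module Defs where

open import Data.Bool.Base using (Bool; if_then_else_)
open import Data.Empty.Polymorphic using (⊥; ⊥-elim)
open import Data.Fin.Base using (Fin; zero; suc; inject₁; fromℕ)
open import Data.List.Base using (List)
open import Data.List.Membership.Propositional using () renaming (_∈_ to _∈ˡ_)
open import Data.List.Relation.Unary.All using (All)
open import Data.Nat.Base using (suc)
open import Data.Product.Base using (Σ; Σ-syntax; ∃-syntax; _×_; _,_)
open import Data.Vec.Functional using (Vector)
open import Function.Bundles using (_⇔_)
open import Level using (Level; Lift; lower) renaming (suc to lsuc)
open import Relation.Binary.Construct.Closure.ReflexiveTransitive using (Star)
open import Relation.Binary.PropositionalEquality using (_≡_)
open import Relation.Nullary.Negation using (¬_)
open import Relation.Unary using (Pred; _∈_; _⊆_; _⊇_; _≐_)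

-- Sets of actions are predicates, so equality of such sets is the
-- extensional _≐_ throughout.

record LTS {ℓ : Level} (Act : Set ℓ) : Set (lsuc ℓ) where
  field
    State     : Set ℓ
    _-[_]→_   : State → Act → State → Set ℓ

module Logic {ℓ : Level} (Act : Set ℓ) where

  infix  9 ~_
  infixr 8 _∙_
  infixr 7 _∧_

  data HML : Set (lsuc ℓ) where
    ⋀   : (I : Set ℓ) → (I → HML) → HML
    _∙_ : Act → HML → HML
    ~_  : HML → HML

  ⊤ : HML
  ⊤ = ⋀ ⊥ ⊥-elim

  _∧_ : HML → HML → HML
  φ ∧ ψ = ⋀ (Lift ℓ Bool) (λ b → if lower b then φ else ψ)

  enabled : Pred Act ℓ → HML
  enabled X = ⋀ (Σ Act (_∈ X)) (λ (a , _) → a ∙ ⊤)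

  disabled : Pred Act ℓ → HML
  disabled X = ⋀ (Σ Act (_∈ X)) (λ (b , _) → ~ (b ∙ ⊤))

  data L′RS : Pred HML (lsuc ℓ) where
    can    : ∀ a → L′RS (a ∙ ⊤)
    cannot : ∀ a → L′RS (~ (a ∙ ⊤))
    conj   : ∀ {I φ} → (∀ i → L′RS (φ i)) → L′RS (⋀ I φ)
    prefix : ∀ a {φ} → L′RS φ → L′RS (a ∙ φ)

  data L′RT : Pred HML (lsuc ℓ) where
    top    : L′RT ⊤
    conj   : ∀ X₁ X₂ {φ} → L′RT φ → L′RT ((enabled X₁ ∧ disabled X₂) ∧ φ)
    prefix : ∀ a {φ} → L′RT φ → L′RT (a ∙ φ)

  data L′FT : Pred HML (lsuc ℓ) where
    top    : L′FT ⊤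
    conj   : ∀ X₁ {φ} → L′FT φ → L′FT (disabled X₁ ∧ φ)
    prefix : ∀ a {φ} → L′FT φ → L′FT (a ∙ φ)

  data L′R : Pred HML (lsuc ℓ) where
    top    : L′R ⊤
    conj   : ∀ X₁ X₂ → L′R (enabled X₁ ∧ disabled X₂)
    prefix : ∀ a {φ} → L′R φ → L′R (a ∙ φ)

  data L′F : Pred HML (lsuc ℓ) where
    top    : L′F ⊤
    conj   : ∀ X₁ → L′F (disabled X₁)
    prefix : ∀ a {φ} → L′F φ → L′F (a ∙ φ)

module Semantics {ℓ : Level} {Act : Set ℓ} (T : LTS Act) where

  open LTS T
  open Logic Act

  infix 4 _⊨_ _⊑[_]_ _≤ˡ_ _≤ˡ⊇_ _≤ˡᶠ_ _≤ˡᶠ⊇_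

  I : State → Pred Act ℓ
  I p a = ∃[ p′ ] p -[ a ]→ p′

  Reachable : State → State → Set ℓ
  Reachable = Star (λ s s′ → ∃[ a ] s -[ a ]→ s′)

  ImageFinite : State → Set ℓ
  ImageFinite p = ∀ {s} → Reachable p s → ∀ a →
    ∃[ xs ] (∀ s′ → s -[ a ]→ s′ ⇔ s′ ∈ˡ xs)

  _⊨_ : State → HML → Set ℓ
  p ⊨ ⋀ J φ = (j : J) → p ⊨ φ j
  p ⊨ a ∙ φ = ∃[ q ] (p -[ a ]→ q × q ⊨ φ)
  p ⊨ ~ φ   = ¬ (p ⊨ φ)

  _⊑[_]_ : State → Pred HML (lsuc ℓ) → State → Set (lsuc ℓ)
  p ⊑[ L ] q = ∀ φ → φ ∈ L → p ⊨ φ → q ⊨ φ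

  -- The finite set of branches is given by a list enumerating it.
  -- BGO below depends neither on the order or multiplicity of branches
  -- nor on the choice of predicates up to _≐_, so inclusions between
  -- sets BGO are those between the corresponding sets of trees.
  data Tree : Set (lsuc ℓ) where
    ⟨_,_⟩ : Pred Act ℓ → List (Act × Tree) → Tree

  data BGO (p : State) : Pred Tree (lsuc ℓ) where
    ⟨_,_⟩ : ∀ {X S} → X ≐ I p →
            All (λ (a , t) → ∃[ p′ ] (p -[ a ]→ p′ × BGO p′ t)) S →
            BGO p ⟨ X , S ⟩

  -- obs X a is the sequence X₀ a₁ X₁ … aₙ Xₙ; since a is indexed from 0,
  -- the action between X (inject₁ i) and X (suc i) is a i.
  data Obs : Set (lsuc ℓ) where
    obs : ∀ {n} → Vector (Pred Act ℓ) (suc n) → Vector Act n → Obs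

  LGO : State → Pred Obs ℓ
  LGO p (obs {n} X a) = Σ[ r ∈ Vector State (suc n) ] (r zero ≡ p
    × (∀ (i : Fin n) → r (inject₁ i) -[ a i ]→ r (suc i))
    × (∀ (i : Fin (suc n)) → X i ≐ I (r i)))

  _≤ˡ_ : State → State → Set (lsuc ℓ)
  p ≤ˡ q = LGO p ⊆ LGO q

  _≤ˡ⊇_ : State → State → Set (lsuc ℓ)
  p ≤ˡ⊇ q = ∀ {n} X (a : Vector Act n) → obs X a ∈ LGO p →
    Σ[ Y ∈ Vector (Pred Act ℓ) (suc n) ] (obs Y a ∈ LGO q × (∀ i → X i ⊇ Y i))

  _≤ˡᶠ_ : State → State → Set (lsuc ℓ)
  p ≤ˡᶠ q = ∀ {n} X (a : Vector Act n) → obs X a ∈ LGO p →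
    Σ[ Y ∈ Vector (Pred Act ℓ) (suc n) ] (obs Y a ∈ LGO q × X (fromℕ n) ≐ Y (fromℕ n))

  _≤ˡᶠ⊇_ : State → State → Set (lsuc ℓ)
  p ≤ˡᶠ⊇ q = ∀ {n} X (a : Vector Act n) → obs X a ∈ LGO p →
    Σ[ Y ∈ Vector (Pred Act ℓ) (suc n) ] (obs Y a ∈ LGO q × X (fromℕ n) ⊇ Y (fromℕ n))

module Submission where

-- Image-finiteness makes I s decidable at every reachable state s, so that
-- X ∪ ∁ X exhausts the actions for every observed ready set X, and a formula
-- enabled X ∧ disabled (∁ X) pins the ready set down without classical logic.
--
-- For the linear semantics, a path of p is turned into a formula describing its
-- ready sets; conversely, a formula satisfied by p only inspects the nodes of one
-- path of p, so it transfers along any path of q matching that one.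
--
-- For the branching semantics, BGO p ⊆ BGO q is itself a ready simulation.  If no
-- a-successor q′ of q has BGO p′ ⊆ BGO q′, then each of the finitely many q′
-- refuses some tree of p′; merging these trees at the root gives one tree of p′
-- refused by all of them.

open import Defs
open import Axiom.ExcludedMiddle using (ExcludedMiddle)
open import Data.Bool.Base using (true; false)
open import Data.Fin.Base using (Fin; zero; suc; inject₁; fromℕ)
open import Data.Fin.Relation.Unary.Top using (view; ‵fromℕ; ‵inject₁)
open import Data.List.Base using (List; []; _∷_; _++_)
open import Data.List.Membership.Propositional using (find)
open import Data.List.Relation.Unary.All using (All; []; _∷_; map; lookup)
open import Data.List.Relation.Unary.All.Properties using (++⁺; ++⁻)
open import Data.List.Relation.Unary.Any using (Any; here; there)
open import Data.Nat.Base using (ℕ; zero; suc)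
open import Data.Product.Base using (Σ-syntax; ∃-syntax; _×_; _,_; proj₁; proj₂)
open import Data.Sum.Base using (_⊎_; inj₁; inj₂)
open import Data.Unit.Polymorphic.Base using (tt)
open import Data.Vec.Functional using (Vector) renaming (_∷_ to _∷ᵛ_; tail to tailᵛ)
open import Function.Base using (_∘_; id)
open import Function.Bundles using (_⇔_; mk⇔; Equivalence)
open import Function.Construct.Composition using (_⇔-∘_)
open import Level using (Level; lift) renaming (suc to lsuc)
open import Relation.Binary.Construct.Always using (Always)
open import Relation.Binary.Construct.Closure.ReflexiveTransitive using (ε; _◅_)
open import Relation.Binary.Core using (Rel)
open import Relation.Binary.PropositionalEquality using (_≡_; refl)
open import Relation.Nullary using (yes; no; ¬_; contradiction)
open import Relation.Nullary.Decidable using (decidable-stable; map′)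
open import Relation.Unary using (Pred; Decidable; ∁; _∈_; _⊆_; _⊇_; _≐_)
open import Relation.Unary.Properties using (≐-refl; ≐-sym; ≐-trans)

module _ {ℓ : Level} {Act : Set ℓ} (T : LTS Act) where

  open LTS T
  open Logic Act
  open Semantics T

  -- Image-finiteness and formulas describing ready sets

  ImageFinite-step : ∀ {s a s′} → ImageFinite s → s -[ a ]→ s′ → ImageFinite s′
  ImageFinite-step fin st reach = fin ((_ , st) ◅ reach)

  -- The finite list of `a`-successors is either empty or has a head, and the head supplies a
  -- transition.
  I? : ∀ {s} → ImageFinite s → Decidable (I s)
  I? fin a with fin ε a
  ... | []     , succ = no λ (s′ , st) → contradiction (Equivalence.to (succ s′) st) λ ()
  ... | x ∷ xs , succ = yes (x , Equivalence.from (succ x) (here refl))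

  ⊨⊤ : ∀ {s} → s ⊨ ⊤
  ⊨⊤ ()

  ⊨∧⁺ : ∀ {s} φ ψ → s ⊨ φ → s ⊨ ψ → s ⊨ φ ∧ ψ
  ⊨∧⁺ φ ψ x y (lift true)  = x
  ⊨∧⁺ φ ψ x y (lift false) = y

  ⊨∧⁻ : ∀ {s} φ ψ → s ⊨ φ ∧ ψ → s ⊨ φ × s ⊨ ψ
  ⊨∧⁻ φ ψ x = x (lift true) , x (lift false)

  ⊨enabled⁺ : ∀ {s X} → X ⊆ I s → s ⊨ enabled X
  ⊨enabled⁺ X⊆I (a , x) = let s′ , st = X⊆I x in s′ , st , ⊨⊤

  ⊨enabled⁻ : ∀ {s X} → s ⊨ enabled X → X ⊆ I s
  ⊨enabled⁻ en x = let s′ , st , _ = en (_ , x) in s′ , st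

  ⊨disabled⁺ : ∀ {s X} → X ⊆ ∁ (I s) → s ⊨ disabled X
  ⊨disabled⁺ X⊆∁I (a , x) (s′ , st , _) = X⊆∁I x (s′ , st)

  ⊨disabled⁻ : ∀ {s X} → s ⊨ disabled X → X ⊆ ∁ (I s)
  ⊨disabled⁻ dis x (s′ , st) = dis (_ , x) (s′ , st , ⊨⊤)

  ⊨disabled∁⁺ : ∀ {s X} → I s ⊆ X → s ⊨ disabled (∁ X)
  ⊨disabled∁⁺ I⊆X = ⊨disabled⁺ λ ¬x i → ¬x (I⊆X i)

  -- The formula says only that no enabled action falls outside `X`; decidability of `X` removes the
  -- resulting double negation.
  ⊨disabled∁⁻ : ∀ {s X} → Decidable X → s ⊨ disabled (∁ X) → I s ⊆ X
  ⊨disabled∁⁻ X? dis {a} i = decidable-stable (X? a) λ ¬x → ⊨disabled⁻ dis ¬x i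

  ⊨disabled-anti : ∀ {s s′ X} → I s′ ⊆ I s → s ⊨ disabled X → s′ ⊨ disabled X
  ⊨disabled-anti I⊆I dis = ⊨disabled⁺ λ x i → ⊨disabled⁻ dis x (I⊆I i)

  ⊨ready-resp : ∀ {s s′} X₁ X₂ → I s ≐ I s′ →
    s ⊨ enabled X₁ ∧ disabled X₂ → s′ ⊨ enabled X₁ ∧ disabled X₂
  ⊨ready-resp X₁ X₂ (I⊆ , I⊇) rdy =
    let en , dis = ⊨∧⁻ (enabled X₁) (disabled X₂) rdy in
    ⊨∧⁺ (enabled X₁) (disabled X₂)
        (⊨enabled⁺ (I⊆ ∘ ⊨enabled⁻ en)) (⊨disabled-anti I⊇ dis)

  ready : Pred Act ℓ → HML
  ready X = enabled X ∧ disabled (∁ X)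

  ⊨ready⁺ : ∀ {s X} → X ≐ I s → s ⊨ ready X
  ⊨ready⁺ {X = X} (X⊆I , I⊆X) =
    ⊨∧⁺ (enabled X) (disabled (∁ X)) (⊨enabled⁺ X⊆I) (⊨disabled∁⁺ I⊆X)

  ⊨ready⁻ : ∀ {s X} → Decidable X → s ⊨ ready X → X ≐ I s
  ⊨ready⁻ {X = X} X? rdy =
    let en , dis = ⊨∧⁻ (enabled X) (disabled (∁ X)) rdy in
    ⊨enabled⁻ en , ⊨disabled∁⁻ X? dis

  -- Linear semantics

  Path : ∀ {n} → State → Vector Act n → Vector State (suc n) → Set ℓ
  Path {n} p a r = r zero ≡ p × (∀ (i : Fin n) → r (inject₁ i) -[ a i ]→ r (suc i))

  path-∷ : ∀ {n p p′ b a} {r : Vector State (suc n)} →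
    p -[ b ]→ p′ → Path p′ a r → Path p (b ∷ᵛ a) (p ∷ᵛ r)
  path-∷ st (refl , sts) = refl , λ { zero → st ; (suc i) → sts i }

  -- Common form of the four linear orders: `M` compares ready sets at the inner nodes of matching
  -- paths and `E` at their last nodes, where `inject₁` never lands. Equality, inclusion or no
  -- condition at all gives the variants.
  module Linear (M E : Rel State ℓ) where

    Follows : ∀ {n} → Vector Act n → Vector State (suc n) → State → Set ℓ
    Follows {n} a r q = Σ[ r′ ∈ Vector State (suc n) ] (Path q a r′
      × (∀ (i : Fin n) → M (r (inject₁ i)) (r′ (inject₁ i)))
      × E (r (fromℕ n)) (r′ (fromℕ n)))

    follows-[] : ∀ {q} a (r : Vector State 1) → E (r zero) q → Follows a r q
    follows-[] {q} a r e = (λ _ → q) , (refl , λ ()) , (λ ()) , e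

    follows-∷ : ∀ {n q q′} a (r : Vector State (suc (suc n))) →
      M (r zero) q → q -[ a zero ]→ q′ → Follows (tailᵛ a) (tailᵛ r) q′ → Follows a r q
    follows-∷ {q = q} a r m st (r′ , (refl , sts) , ms , e) =
      q ∷ᵛ r′ ,
      (refl , λ { zero → st ; (suc i) → sts i }) ,
      (λ { zero → m ; (suc i) → ms i }) ,
      e

    follows-uncons : ∀ {n q} a (r : Vector State (suc (suc n))) → Follows a r q →
      M (r zero) q × ∃[ q′ ] (q -[ a zero ]→ q′ × Follows (tailᵛ a) (tailᵛ r) q′)
    follows-uncons a r (r′ , (refl , sts) , ms , e) =
      ms zero , r′ (suc zero) , sts zero ,
      (tailᵛ r′ , (refl , sts ∘ suc) , ms ∘ suc , e)

    _≼_ : State → State → Set ℓ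
    p ≼ q = ∀ n (a : Vector Act n) r → Path p a r → Follows a r q

    -- Records the single path of `p` that the truth of `φ` depends on, so that `φ` can be carried
    -- to any state following it.
    Certified : State → HML → Set ℓ
    Certified p φ = Σ[ n ∈ ℕ ] Σ[ a ∈ Vector Act n ] Σ[ r ∈ Vector State (suc n) ]
      (Path p a r × (∀ {q} → Follows a r q → q ⊨ φ))

    certified-end : ∀ {p} φ → (∀ {q} → E p q → q ⊨ φ) → Certified p φ
    certified-end {p} φ E⇒φ =
      0 , (λ ()) , (λ _ → p) , (refl , λ ()) , λ { (_ , (refl , _) , _ , e) → E⇒φ e }

    certified-⊤ : ∀ {p} → Certified p ⊤
    certified-⊤ = certified-end ⊤ λ _ → ⊨⊤

    certified-∙ : ∀ {p p′} b {φ} → p -[ b ]→ p′ → Certified p′ φ → Certified p (b ∙ φ)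
    certified-∙ {p} b st (n , a , r , π , cert) =
      suc n , b ∷ᵛ a , p ∷ᵛ r , path-∷ st π , λ fol →
      let _ , q′ , st′ , fol′ = follows-uncons (b ∷ᵛ a) (p ∷ᵛ r) fol in q′ , st′ , cert fol′

    -- Here `φ` speaks of the root. The root is the last node of a path of length zero, governed by
    -- `E`, and otherwise an inner node, governed by `M`; hence the two hypotheses.
    certified-∧ : ∀ {p} φ ψ → (∀ {q} → M p q → q ⊨ φ) → (∀ {q} → E p q → q ⊨ φ) →
      Certified p ψ → Certified p (φ ∧ ψ)
    certified-∧ φ ψ M⇒φ E⇒φ (zero , a , r , π@(refl , _) , cert) =
      zero , a , r , π , λ { fol@(_ , (refl , _) , _ , e) → ⊨∧⁺ φ ψ (E⇒φ e) (cert fol) }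
    certified-∧ φ ψ M⇒φ E⇒φ (suc n , a , r , π@(refl , _) , cert) =
      suc n , a , r , π , λ fol → ⊨∧⁺ φ ψ (M⇒φ (proj₁ (follows-uncons a r fol))) (cert fol)

    -- D decorates the inner nodes of a path and F the last one.
    module _ (L : Pred HML (lsuc ℓ)) (D : State → HML → HML) (F : State → HML)
      (F∈L : ∀ s → F s ∈ L)
      (D∈L : ∀ s a {φ} → φ ∈ L → D s (a ∙ φ) ∈ L)
      (F⁺  : ∀ s → s ⊨ F s)
      (D⁺  : ∀ s φ → s ⊨ φ → s ⊨ D s φ)
      (F⁻  : ∀ {s q} → ImageFinite s → q ⊨ F s → E s q)
      (D⁻  : ∀ {s q} φ → ImageFinite s → q ⊨ D s φ → M s q × q ⊨ φ)
      (certify : ∀ {φ p} → φ ∈ L → p ⊨ φ → Certified p φ)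
      where

      -- Characteristic formula of a path: true at its starting state and, under image-finiteness,
      -- only at states with a matching path.
      χ : ∀ {n} → Vector Act n → Vector State (suc n) → HML
      χ {zero}  a r = F (r zero)
      χ {suc n} a r = D (r zero) (a zero ∙ χ (tailᵛ a) (tailᵛ r))

      χ∈L : ∀ {n} (a : Vector Act n) r → χ a r ∈ L
      χ∈L {zero}  a r = F∈L (r zero)
      χ∈L {suc n} a r = D∈L (r zero) (a zero) (χ∈L (tailᵛ a) (tailᵛ r))

      ⊨χ⁺ : ∀ {n p} (a : Vector Act n) r → Path p a r → p ⊨ χ a r
      ⊨χ⁺ {zero}  a r (refl , _)   = F⁺ (r zero)
      ⊨χ⁺ {suc n} a r (refl , sts) =
        D⁺ (r zero) _ (r (suc zero) , sts zero , ⊨χ⁺ (tailᵛ a) (tailᵛ r) (refl , sts ∘ suc))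

      ⊨χ⁻ : ∀ {n p q} (a : Vector Act n) r → ImageFinite p → Path p a r →
        q ⊨ χ a r → Follows a r q
      ⊨χ⁻ {zero}  a r fin (refl , _)   sat = follows-[] a r (F⁻ fin sat)
      ⊨χ⁻ {suc n} a r fin (refl , sts) sat =
        let m , q′ , st , sat′ = D⁻ (a zero ∙ χ (tailᵛ a) (tailᵛ r)) fin sat in
        follows-∷ a r m st
          (⊨χ⁻ (tailᵛ a) (tailᵛ r) (ImageFinite-step fin (sts zero)) (refl , sts ∘ suc) sat′)

      ⊑⇔≼ : ∀ {p q} → ImageFinite p → p ⊑[ L ] q ⇔ p ≼ q
      ⊑⇔≼ fin = mk⇔
        (λ p⊑q n a r π → ⊨χ⁻ a r fin π (p⊑q (χ a r) (χ∈L a r) (⊨χ⁺ a r π)))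
        (λ p≼q φ φ∈L sat →
          let n , a , r , π , cert = certify φ∈L sat in cert (p≼q n a r π))

  -- The four linear equivalences

  _I≐_ _I⊇_ : Rel State ℓ
  s I≐ s′ = I s ≐ I s′
  s I⊇ s′ = I s ⊇ I s′

  everywhere : ∀ {n ℓ′} {P : Fin (suc n) → Set ℓ′} →
    (∀ i → P (inject₁ i)) → P (fromℕ n) → ∀ i → P i
  everywhere inner last i with view i
  ... | ‵fromℕ     = last
  ... | ‵inject₁ j = inner j

  module RT where
    open Linear _I≐_ _I≐_

    certify : ∀ {φ p} → φ ∈ L′RT → p ⊨ φ → Certified p φ
    certify top _ = certified-⊤
    certify (prefix a φ∈) (_ , st , sat) = certified-∙ a st (certify φ∈ sat)
    certify (conj X₁ X₂ {φ} φ∈) sat =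
      let rdy , sat′ = ⊨∧⁻ (enabled X₁ ∧ disabled X₂) φ sat
          keep : ∀ {q} → _ I≐ q → q ⊨ enabled X₁ ∧ disabled X₂
          keep I≐I = ⊨ready-resp X₁ X₂ I≐I rdy
      in certified-∧ (enabled X₁ ∧ disabled X₂) φ keep keep (certify φ∈ sat′)

    logical : ∀ {p q} → ImageFinite p → p ⊑[ L′RT ] q ⇔ p ≼ q
    -- The last node is closed with `⊤`, since the conjunctive clause of `L′RT` must continue with a
    -- formula.
    logical = ⊑⇔≼ L′RT (λ s φ → ready (I s) ∧ φ) (λ s → ready (I s) ∧ ⊤)
      (λ s → conj _ _ top)
      (λ s a φ∈ → conj _ _ (prefix a φ∈))
      (λ s → ⊨∧⁺ (ready (I s)) ⊤ (⊨ready⁺ ≐-refl) ⊨⊤)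
      (λ s φ sat → ⊨∧⁺ (ready (I s)) φ (⊨ready⁺ ≐-refl) sat)
      (λ fin sat → ⊨ready⁻ (I? fin) (proj₁ (⊨∧⁻ (ready _) ⊤ sat)))
      (λ φ fin sat → let rdy , sat′ = ⊨∧⁻ (ready _) φ sat in ⊨ready⁻ (I? fin) rdy , sat′)
      certify

    observational : ∀ {p q} → p ≼ q ⇔ p ≤ˡ q
    observational = mk⇔
      (λ { p≼q {obs X a} (r , r₀ , sts , X≐I) →
           let r′ , (r₀′ , sts′) , ms , e = p≼q _ a r (r₀ , sts) in
           r′ , r₀′ , sts′ , λ i → ≐-trans (X≐I i) (everywhere {P = λ i → r i I≐ r′ i} ms e i) })
      (λ p≤q n a r (r₀ , sts) →
           -- Labelling the path with its exact ready sets forces `q` to answer with a path having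
           -- the same ones.
           let r′ , r₀′ , sts′ , I≐I = p≤q {obs (I ∘ r) a} (r , r₀ , sts , λ _ → ≐-refl) in
           r′ , (r₀′ , sts′) , I≐I ∘ inject₁ , I≐I (fromℕ n))

  module FT where
    open Linear _I⊇_ _I⊇_

    certify : ∀ {φ p} → φ ∈ L′FT → p ⊨ φ → Certified p φ
    certify top _ = certified-⊤
    certify (prefix a φ∈) (_ , st , sat) = certified-∙ a st (certify φ∈ sat)
    certify (conj X₁ {φ} φ∈) sat =
      let dis , sat′ = ⊨∧⁻ (disabled X₁) φ sat
          keep : ∀ {q} → _ I⊇ q → q ⊨ disabled X₁
          keep I⊇I = ⊨disabled-anti I⊇I dis
      in certified-∧ (disabled X₁) φ keep keep (certify φ∈ sat′)

    logical : ∀ {p q} → ImageFinite p → p ⊑[ L′FT ] q ⇔ p ≼ q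
    logical = ⊑⇔≼ L′FT (λ s φ → disabled (∁ (I s)) ∧ φ) (λ s → disabled (∁ (I s)) ∧ ⊤)
      (λ s → conj _ top)
      (λ s a φ∈ → conj _ (prefix a φ∈))
      (λ s → ⊨∧⁺ (disabled (∁ (I s))) ⊤ (⊨disabled∁⁺ id) ⊨⊤)
      (λ s φ sat → ⊨∧⁺ (disabled (∁ (I s))) φ (⊨disabled∁⁺ id) sat)
      (λ fin sat → ⊨disabled∁⁻ (I? fin) (proj₁ (⊨∧⁻ (disabled (∁ (I _))) ⊤ sat)))
      (λ φ fin sat →
        let dis , sat′ = ⊨∧⁻ (disabled (∁ (I _))) φ sat in ⊨disabled∁⁻ (I? fin) dis , sat′)
      certify

    observational : ∀ {p q} → p ≼ q ⇔ p ≤ˡ⊇ q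
    observational = mk⇔
      (λ p≼q {n} X a (r , r₀ , sts , X≐I) →
         let r′ , (r₀′ , sts′) , ms , e = p≼q _ a r (r₀ , sts) in
         -- The witness `Y` consists of the ready sets that `q` itself meets along the matching
         -- path.
         I ∘ r′ , (r′ , r₀′ , sts′ , λ _ → ≐-refl) ,
         λ i → proj₂ (X≐I i) ∘ everywhere {P = λ i → r i I⊇ r′ i} ms e i)
      (λ p≤q n a r (r₀ , sts) →
         let Y , (r′ , r₀′ , sts′ , Y≐I) , I⊇Y = p≤q (I ∘ r) a (r , r₀ , sts , λ _ → ≐-refl)
             I⊇I = λ i {x} → I⊇Y i {x} ∘ proj₂ (Y≐I i)
         in r′ , (r₀′ , sts′) , (λ i → I⊇I (inject₁ i)) , I⊇I (fromℕ n))

  module R where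
    open Linear Always _I≐_

    certify : ∀ {φ p} → φ ∈ L′R → p ⊨ φ → Certified p φ
    certify top _ = certified-⊤
    certify (prefix a φ∈) (_ , st , sat) = certified-∙ a st (certify φ∈ sat)
    certify (conj X₁ X₂) rdy =
      certified-end (enabled X₁ ∧ disabled X₂) λ I≐I → ⊨ready-resp X₁ X₂ I≐I rdy

    logical : ∀ {p q} → ImageFinite p → p ⊑[ L′R ] q ⇔ p ≼ q
    -- Inner nodes are unconstrained, so their decoration is the identity.
    logical = ⊑⇔≼ L′R (λ _ φ → φ) (λ s → ready (I s))
      (λ s → conj _ _)
      (λ s a φ∈ → prefix a φ∈)
      (λ s → ⊨ready⁺ ≐-refl)
      (λ s φ sat → sat)
      (λ fin sat → ⊨ready⁻ (I? fin) sat)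
      (λ φ fin sat → tt , sat)
      certify

    observational : ∀ {p q} → p ≼ q ⇔ p ≤ˡᶠ q
    observational = mk⇔
      (λ p≼q {n} X a (r , r₀ , sts , X≐I) →
         let r′ , (r₀′ , sts′) , _ , e = p≼q _ a r (r₀ , sts) in
         I ∘ r′ , (r′ , r₀′ , sts′ , λ _ → ≐-refl) , ≐-trans (X≐I (fromℕ n)) e)
      (λ p≤q n a r (r₀ , sts) →
         let Y , (r′ , r₀′ , sts′ , Y≐I) , I≐Y = p≤q (I ∘ r) a (r , r₀ , sts , λ _ → ≐-refl) in
         r′ , (r₀′ , sts′) , _ , ≐-trans I≐Y (Y≐I (fromℕ n)))

  module F where
    open Linear Always _I⊇_

    certify : ∀ {φ p} → φ ∈ L′F → p ⊨ φ → Certified p φ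
    certify top _ = certified-⊤
    certify (prefix a φ∈) (_ , st , sat) = certified-∙ a st (certify φ∈ sat)
    certify (conj X₁) dis = certified-end (disabled X₁) λ I⊇I → ⊨disabled-anti I⊇I dis

    logical : ∀ {p q} → ImageFinite p → p ⊑[ L′F ] q ⇔ p ≼ q
    logical = ⊑⇔≼ L′F (λ _ φ → φ) (λ s → disabled (∁ (I s)))
      (λ s → conj _)
      (λ s a φ∈ → prefix a φ∈)
      (λ s → ⊨disabled∁⁺ id)
      (λ s φ sat → sat)
      (λ fin sat → ⊨disabled∁⁻ (I? fin) sat)
      (λ φ fin sat → tt , sat)
      certify

    observational : ∀ {p q} → p ≼ q ⇔ p ≤ˡᶠ⊇ q
    observational = mk⇔
      (λ p≼q {n} X a (r , r₀ , sts , X≐I) →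
         let r′ , (r₀′ , sts′) , _ , e = p≼q _ a r (r₀ , sts) in
         I ∘ r′ , (r′ , r₀′ , sts′ , λ _ → ≐-refl) , proj₂ (X≐I (fromℕ n)) ∘ e)
      (λ p≤q n a r (r₀ , sts) →
         let Y , (r′ , r₀′ , sts′ , Y≐I) , I⊇Y = p≤q (I ∘ r) a (r , r₀ , sts , λ _ → ≐-refl) in
         r′ , (r₀′ , sts′) , _ , I⊇Y ∘ proj₂ (Y≐I (fromℕ n)))

  -- Branching semantics

  L′RS-∧ : ∀ {φ ψ} → L′RS φ → L′RS ψ → L′RS (φ ∧ ψ)
  L′RS-∧ φ∈ ψ∈ = conj λ { (lift true) → φ∈ ; (lift false) → ψ∈ }

  mutual
    χᵗ : Tree → HML
    χᵗ ⟨ X , S ⟩ = ready X ∧ χᵇ S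

    χᵇ : List (Act × Tree) → HML
    χᵇ []            = ⊤
    χᵇ ((a , t) ∷ S) = a ∙ χᵗ t ∧ χᵇ S

  mutual
    χᵗ∈L′RS : ∀ t → χᵗ t ∈ L′RS
    χᵗ∈L′RS ⟨ X , S ⟩ =
      L′RS-∧ (L′RS-∧ (conj λ (a , _) → can a) (conj λ (b , _) → cannot b)) (χᵇ∈L′RS S)

    χᵇ∈L′RS : ∀ S → χᵇ S ∈ L′RS
    χᵇ∈L′RS []            = conj λ ()
    χᵇ∈L′RS ((a , t) ∷ S) = L′RS-∧ (prefix a (χᵗ∈L′RS t)) (χᵇ∈L′RS S)

  Branch : State → Pred (Act × Tree) (lsuc ℓ)
  Branch p (a , t) = ∃[ p′ ] (p -[ a ]→ p′ × BGO p′ t)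

  mutual
    ⊨χᵗ⁺ : ∀ {p t} → BGO p t → p ⊨ χᵗ t
    ⊨χᵗ⁺ {t = ⟨ X , S ⟩} ⟨ X≐I , bs ⟩ = ⊨∧⁺ (ready X) (χᵇ S) (⊨ready⁺ X≐I) (⊨χᵇ⁺ bs)

    ⊨χᵇ⁺ : ∀ {p S} → All (Branch p) S → p ⊨ χᵇ S
    ⊨χᵇ⁺ [] = ⊨⊤
    ⊨χᵇ⁺ {S = (a , t) ∷ S} ((p′ , st , b) ∷ bs) =
      ⊨∧⁺ (a ∙ χᵗ t) (χᵇ S) (p′ , st , ⊨χᵗ⁺ b) (⊨χᵇ⁺ bs)

  mutual
    -- The hypothesis `BGO p t` identifies every label in `t` with the ready set of a state
    -- reachable from `p`. Such labels are decidable, so `q` satisfying the formula pins its own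
    -- ready sets to them.
    ⊨χᵗ⁻ : ∀ {p q t} → ImageFinite p → BGO p t → q ⊨ χᵗ t → BGO q t
    ⊨χᵗ⁻ {t = ⟨ X , S ⟩} fin ⟨ (X⊆I , I⊆X) , bs ⟩ sat =
      let rdy , sat′ = ⊨∧⁻ (ready X) (χᵇ S) sat in
      ⟨ ⊨ready⁻ (λ a → map′ I⊆X X⊆I (I? fin a)) rdy , ⊨χᵇ⁻ fin bs sat′ ⟩

    ⊨χᵇ⁻ : ∀ {p q S} → ImageFinite p → All (Branch p) S → q ⊨ χᵇ S → All (Branch q) S
    ⊨χᵇ⁻ fin [] _ = []
    ⊨χᵇ⁻ {S = (a , t) ∷ S} fin ((_ , st , b) ∷ bs) sat =
      let (q′ , st′ , sat₁) , sat₂ = ⊨∧⁻ (a ∙ χᵗ t) (χᵇ S) sat in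
      (q′ , st′ , ⊨χᵗ⁻ (ImageFinite-step fin st) b sat₁) ∷ ⊨χᵇ⁻ fin bs sat₂

  ⊑RS⇒BGO⊆ : ∀ {p q} → ImageFinite p → p ⊑[ L′RS ] q → BGO p ⊆ BGO q
  ⊑RS⇒BGO⊆ fin p⊑q {t} b = ⊨χᵗ⁻ fin b (p⊑q (χᵗ t) (χᵗ∈L′RS t) (⊨χᵗ⁺ b))

  -- Inclusion of trees as a ready simulation

  BGO⊆⇒I≐ : ∀ {p q} → BGO p ⊆ BGO q → I p ≐ I q
  -- The bare root labelled `I p` is a tree of `p`, hence one of `q`.
  BGO⊆⇒I≐ p⊆q with p⊆q ⟨ ≐-refl , [] ⟩
  ... | ⟨ I≐I , _ ⟩ = I≐I

  -- Two trees of the same state have equal root labels, so their branch lists can be concatenated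
  -- under one root.
  BGO-merge : ∀ {p t u} → BGO p t → BGO p u →
    ∃[ v ] (BGO p v × (∀ {s} → BGO s v → BGO s t × BGO s u))
  BGO-merge (⟨_,_⟩ {X} {S} X≐I bs) (⟨_,_⟩ {Y} {S′} Y≐I bs′) =
    ⟨ X , S ++ S′ ⟩ , ⟨ X≐I , ++⁺ bs bs′ ⟩ , λ { ⟨ X≐Is , cs ⟩ →
    let cs₁ , cs₂ = ++⁻ S cs in
    ⟨ X≐Is , cs₁ ⟩ , ⟨ ≐-trans Y≐I (≐-trans (≐-sym X≐I) X≐Is) , cs₂ ⟩ }

  module _ (em : ExcludedMiddle (lsuc ℓ)) where

    -- Excluded middle does its work here: either a separating tree exists, or its absence gives
    -- inclusion by double negation.
    included? : ∀ p s → BGO p ⊆ BGO s ⊎ ∃[ t ] (BGO p t × ¬ BGO s t)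
    included? p s with em {∃[ t ] (BGO p t × ¬ BGO s t)}
    ... | yes sep = inj₂ sep
    ... | no ¬sep = inj₁ λ {t} b → decidable-stable em λ ¬b → ¬sep (t , b , ¬b)

    includedSome? : ∀ p ss → Any (λ s → BGO p ⊆ BGO s) ss
      ⊎ ∃[ t ] (BGO p t × All (λ s → ¬ BGO s t) ss)
    -- With no candidate to refuse the tree, any tree of `p` serves; the bare root is one.
    includedSome? p [] = inj₂ (_ , ⟨ ≐-refl , [] ⟩ , [])
    includedSome? p (s ∷ ss) with included? p s | includedSome? p ss
    ... | inj₁ p⊆s          | _              = inj₁ (here p⊆s)
    ... | inj₂ _            | inj₁ some      = inj₁ (there some)
    ... | inj₂ (t , b , ¬b) | inj₂ (u , c , ¬cs) =
      let v , d , split = BGO-merge b c in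
      inj₂ (v , d , ¬b ∘ proj₁ ∘ split ∷ map (_∘ proj₂ ∘ split) ¬cs)

    BGO⊆-simulates : ∀ {p q a p′} → ImageFinite q → BGO p ⊆ BGO q → p -[ a ]→ p′ →
      ∃[ q′ ] (q -[ a ]→ q′ × BGO p′ ⊆ BGO q′)
    BGO⊆-simulates {a = a} {p′} fin p⊆q st with fin ε a
    ... | qs , succ with includedSome? p′ qs
    ...   | inj₁ some = let q′ , q′∈ , p′⊆q′ = find some in
                        q′ , Equivalence.from (succ q′) q′∈ , p′⊆q′
    -- Hanging the refused tree `t` below an `a`-branch of `p` yields a tree that `q` can match only
    -- through an `a`-successor having `t`.
    ...   | inj₂ (t , b , ¬bs) with p⊆q ⟨ ≐-refl , (p′ , st , b) ∷ [] ⟩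
    ...     | ⟨ _ , (q′ , st′ , b′) ∷ [] ⟩ =
      contradiction b′ (lookup ¬bs (Equivalence.to (succ q′) st′))

    BGO⊆⇒⊑RS : ∀ {p q} → ImageFinite q → BGO p ⊆ BGO q → p ⊑[ L′RS ] q
    BGO⊆⇒⊑RS fin p⊆q _ (can a) (_ , st , _) =
      let q′ , st′ = proj₁ (BGO⊆⇒I≐ p⊆q) (_ , st) in q′ , st′ , ⊨⊤
    -- Refusals transfer by the reverse inclusion of ready sets, from `q` back to `p`.
    BGO⊆⇒⊑RS fin p⊆q _ (cannot a) ¬a (_ , st , _) =
      let p′ , st′ = proj₂ (BGO⊆⇒I≐ p⊆q) (_ , st) in ¬a (p′ , st′ , ⊨⊤)
    BGO⊆⇒⊑RS fin p⊆q _ (conj φ∈) sat j = BGO⊆⇒⊑RS fin p⊆q _ (φ∈ j) (sat j)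
    BGO⊆⇒⊑RS fin p⊆q _ (prefix a φ∈) (_ , st , sat) =
      let q′ , st′ , p′⊆q′ = BGO⊆-simulates fin p⊆q st in
      q′ , st′ , BGO⊆⇒⊑RS (ImageFinite-step fin st′) p′⊆q′ _ φ∈ sat

theorem3 : {ℓ : Level} {Act : Set ℓ} (T : LTS Act) →
  let open LTS T
      open Logic Act
      open Semantics T
  in (p q : State) → ImageFinite p → ImageFinite q →
     (ExcludedMiddle (lsuc ℓ) → (p ⊑[ L′RS ] q ⇔ BGO p ⊆ BGO q))
     × (p ⊑[ L′RT ] q ⇔ p ≤ˡ q)
     × (p ⊑[ L′FT ] q ⇔ p ≤ˡ⊇ q)
     × (p ⊑[ L′R ] q ⇔ p ≤ˡᶠ q)
     × (p ⊑[ L′F ] q ⇔ p ≤ˡᶠ⊇ q)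
theorem3 T p q p-fin q-fin =
  -- Finiteness of `p` makes the tree labels decidable; finiteness of `q` leaves finitely many
  -- successors to separate from.
  (λ em → mk⇔ (⊑RS⇒BGO⊆ T p-fin) (BGO⊆⇒⊑RS T em q-fin)) ,
  RT.observational T ⇔-∘ RT.logical T p-fin ,
  FT.observational T ⇔-∘ FT.logical T p-fin ,
  R.observational T ⇔-∘ R.logical T p-fin ,
  F.observational T ⇔-∘ F.logical T p-fin
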